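{- Let $\equiv$ be either $\equiv_{s,a}$ or $\equiv_{s,s}$. Let $T=\langle P,Q\rangle$ be an NSV-tuple, let $I_k$ be an independent set of $T$, let $a'\notin at(T)$ be a fresh atom, and let $T^\oplus=\langle P^\oplus,Q^\oplus\rangle$ be obtained from $T$ by adding $a'$ to $I_k$, and suppose $T^\oplus$ is also an NSV-tuple. Then $P\not\equiv Q$ implies $P^\oplus\not\equiv Q^\oplus$, and $P^\oplus\equiv Q^\oplus$ implies $P\equiv Q$.
   Context: Atoms are propositional. A rule $r$ is an expression $h_1\vee\cdots\vee h_k\leftarrow b_1,\dots,b_m,\mathit{not}\,c_1,\dots,\mathit{not}\,c_n$; write $H(r)$, $B^+(r)$, $B^-(r)$ for the sets of head, positive body and negative body atoms. An interpretation $X$ satisfies $r$ iff $X\cap H(r)\neq\emptyset$ or $B^+(r)\not\subseteq X$ or $B^-(r)\cap X\neq\emptyset$. GL-reduct $P^X=\{H(r)\leftarrow B^+(r) : r\in P,\ B^-(r)\cap X=\emptyset\}$; $X$ is an ASP stable model of a program $P$ iff $X\models P^X$ and no proper subset of $X$ satisfies $P^X$; $X$ is an LP$^{\mathrm{MLN}}$ stable model of $P$ (weights omitted) iff $X$ is an ASP stable model of $\{r\in P: X\models r\}$. $P\equiv_{s,a}Q$ (resp. $P\equiv_{s,s}Q$) iff for every program $R$, $P\cup R$ and $Q\cup R$ have the same ASP (resp. LP$^{\mathrm{MLN}}$) stable models. Programs are regarded as tuples of rules; $\langle P,Q\rangle$ is the concatenation, and a result tuple is split into its first $|P|$ rules and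 the rest. For a tuple $T=\langle r_1,\dots,r_n\rangle$ with atom set $at(T)$ let $\langle S_1,\dots,S_{3n}\rangle=\langle H(r_1),B^+(r_1),B^-(r_1),\dots,H(r_n),B^+(r_n),B^-(r_n)\rangle$; for nonempty $N'\subseteq\{1,\dots,3n\}$ the independent set is $I_{N'}=\bigcap_{i\in N'}S_i\setminus\bigcup_{j\notin N'}S_j$. Adding a fresh atom $a'$ to $I_{N'}$ means adding $a'$ to each $S_i$, $i\in N'$. $T$ is singleton if every nonempty independent set of $T$ has exactly one element. $T$ is an NSV-tuple if it is singleton and every rule $r$ of $T$ satisfies $B^+(r)\cap(H(r)\cup B^-(r))=\emptyset$. -}

module Defs where

open import Data.Nat using (ℕ; _≟_)
open import Data.Bool using (Bool; true; false; if_then_else_)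
open import Data.Fin using (Fin; zero; suc)
open import Data.List using (List; []; _∷_; _++_; length; filter; map; take; drop; lookup)
open import Data.List.Membership.Propositional using (_∈_; _∉_)
open import Data.List.Membership.DecPropositional _≟_ using (_∈?_)
open import Data.List.Relation.Unary.All using (All; all?)
open import Data.List.Relation.Unary.Any using (Any; any?)
open import Data.List.Relation.Binary.Subset.Propositional using (_⊆_)
open import Data.Product using (Σ; _×_; ∃; ∃-syntax; _,_)
open import Data.Sum using (_⊎_)
open import Relation.Nullary using (¬_; Dec)
open import Relation.Nullary.Decidable using (_⊎-dec_; ¬?)
open import Relation.Binary.PropositionalEquality using (_≡_)
open import Function.Bundles using (_⇔_)

Atom : Set
Atom = ℕ

-- h₁ ∨ … ∨ hₖ ← b₁,…,bₘ, not c₁,…,not cₙ   (atom sets as finite lists)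
record Rule : Set where
  constructor mkRule
  field
    H  : List Atom
    B⁺ : List Atom
    B⁻ : List Atom
open Rule public

Program : Set
Program = List Rule

-- interpretations: finite sets of atoms
Interp : Set
Interp = List Atom

_⊨_ : Interp → Rule → Set
X ⊨ r = Any (_∈ X) (H r) ⊎ (¬ All (_∈ X) (B⁺ r) ⊎ Any (_∈ X) (B⁻ r))

_⊨?_ : (X : Interp) → (r : Rule) → Dec (X ⊨ r)
X ⊨? r = any? (_∈? X) (H r) ⊎-dec (¬? (all? (_∈? X) (B⁺ r)) ⊎-dec any? (_∈? X) (B⁻ r))

_⊨P_ : Interp → Program → Set
X ⊨P P = All (X ⊨_) P

reduct : Program → Interp → Program
reduct P X =
  map (λ r → mkRule (H r) (B⁺ r) [])
      (filter (λ r → all? (λ a → ¬? (a ∈? X)) (B⁻ r)) P)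

StableASP : Program → Interp → Set
StableASP P X =
  (X ⊨P reduct P X) ×
  ¬ (Σ Interp λ Y → (Y ⊆ X) × ¬ (X ⊆ Y) × (Y ⊨P reduct P X))

satRules : Program → Interp → Program
satRules P X = filter (X ⊨?_) P

-- LP^MLN stable model (weights omitted)
StableLPMLN : Program → Interp → Set
StableLPMLN P X = StableASP (satRules P X) X

data Semantics : Set where
  asp lpmln : Semantics

Stable : Semantics → Program → Interp → Set
Stable asp   = StableASP
Stable lpmln = StableLPMLN

StrongEq : Semantics → Program → Program → Set
StrongEq sem P Q = ∀ (R : Program) (X : Interp) →
  Stable sem (P ++ R) X ⇔ Stable sem (Q ++ R) X

-- Tuples, positions, independent sets
--
-- The 3n sets ⟨S₁,…,S₃ₙ⟩ are indexed by pairs (i , c) with i : Fin n the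
-- rule index and c ∈ {head, pos, neg} the component (bijective with 1..3n).

data Comp : Set where
  head pos neg : Comp

comp : Comp → Rule → List Atom
comp head r = H r
comp pos  r = B⁺ r
comp neg  r = B⁻ r

S : (T : Program) → Fin (length T) → Comp → List Atom
S T i c = comp c (lookup T i)

Positions : Program → Set
Positions T = Fin (length T) → Comp → Bool

NonEmpty : {T : Program} → Positions T → Set
NonEmpty N = Σ _ λ i → Σ Comp λ c → N i c ≡ true

InIndep : (T : Program) → Positions T → Atom → Set
InIndep T N a = ∀ i c → (N i c ≡ true → a ∈ S T i c) × (N i c ≡ false → a ∉ S T i c)

Singleton : Program → Set
Singleton T = ∀ (N : Positions T) → NonEmpty {T} N →
  ∀ a b → InIndep T N a → InIndep T N b → a ≡ b

Disjoint : List Atom → List Atom → Set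
Disjoint A B = ∀ a → a ∈ A → a ∉ B

NSV : Program → Set
NSV T = Singleton T × All (λ r → Disjoint (B⁺ r) (H r) × Disjoint (B⁺ r) (B⁻ r)) T

InAt : Program → Atom → Set
InAt T a = Σ _ λ i → Σ Comp λ c → a ∈ S T i c

addIf : Bool → Atom → List Atom → List Atom
addIf b a A = if b then a ∷ A else A

addRule : (Comp → Bool) → Atom → Rule → Rule
addRule N a r = mkRule (addIf (N head) a (H r)) (addIf (N pos) a (B⁺ r)) (addIf (N neg) a (B⁻ r))

addAtom : (T : Program) → Positions T → Atom → Program
addAtom []      N a = []
addAtom (r ∷ T) N a = addRule (N zero) a r ∷ addAtom T (λ i → N (suc i)) a

{-# OPTIONS --safe #-}

-- Under both semantics, strong equivalence of P and Q means that P and Q have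
-- the same SE-models (X , Y), X ⊆ Y; being an SE-model is a conjunction of
-- conditions on single rules.  Let r⊕ be r with a' added, a' not occurring in
-- both the positive body and another component of r⊕.  Evaluated at pairs
-- without a', r⊕ is trivial if a' is in its positive body and behaves like r
-- otherwise; evaluated at pairs with a' in both members, r⊕ is trivial if a' is
-- in its head or negative body and behaves like r otherwise.  Hence (X , Y) is
-- an SE-model of P iff both (X ∖ a' , Y ∖ a') and (X ∪ a' , Y ∪ a') are
-- SE-models of P⊕, so the SE-models of P⊕ determine those of P.

module Submission where

open import Defs
open import Data.Bool using (Bool; true; false)
open import Data.Empty using (⊥-elim)
open import Data.Fin using (zero; suc)
open import Data.List using (List; []; _∷_; _++_; length; take; drop; map; filter; cartesianProductWith)
open import Data.List.Membership.Propositional using (_∈_; _∉_; find)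
open import Data.List.Membership.Propositional.Properties using (∈-filter⁺; ∈-filter⁻; ∈-cartesianProductWith⁺; ∈-cartesianProductWith⁻)
open import Data.List.Relation.Binary.Pointwise using (Pointwise; []; _∷_)
open import Data.List.Relation.Binary.Subset.Propositional using (_⊆_)
open import Data.List.Relation.Unary.All as All using (All; []; _∷_; all?)
open import Data.List.Relation.Unary.All.Properties using (¬Any⇒All¬; All¬⇒¬Any; ¬All⇒Any¬; map⁺; map⁻; ++⁺; ++⁻)
open import Data.List.Relation.Unary.Any using (Any; here; there)
open import Data.Nat using (_≟_)
open import Data.List.Membership.DecPropositional _≟_ using (_∈?_)
open import Data.Product using (_×_; _,_; proj₁; proj₂)
open import Data.Sum using (_⊎_; inj₁; inj₂)
import Data.Sum as Sum
open import Function.Base using (_∘_; id)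
open import Function.Bundles using (_⇔_; mk⇔; module Equivalence)
open import Function.Construct.Symmetry using (⇔-sym)
open import Relation.Binary.PropositionalEquality using (_≡_; refl)
open import Relation.Nullary using (¬_; yes; no)
open import Relation.Nullary.Decidable using (¬?; _→-dec_)
open import Relation.Unary using (Decidable)

open Equivalence using (to; from)

private
  variable
    a b : Atom
    A X X' Y Y' Z : List Atom
    r r' : Rule
    P P' Q Q' : Program

-- Turns each deletion of rules, by `reduct` or by `satRules`, into a hypothesis on the single rule.
All-filter⇔ : ∀ {E : Set} {F G : E → Set} (F? : Decidable F) (xs : List E) →
  All G (filter F? xs) ⇔ All (λ x → F x → G x) xs
All-filter⇔ {F = F} {G} F? xs = mk⇔ (fwd xs) (bwd xs)
  where
  fwd : ∀ xs → All G (filter F? xs) → All (λ x → F x → G x) xs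
  fwd []       gs = []
  fwd (x ∷ xs) gs with F? x
  fwd (x ∷ xs) (g ∷ gs) | yes _ = (λ _ → g) ∷ fwd xs gs
  fwd (x ∷ xs) gs       | no ¬f = (⊥-elim ∘ ¬f) ∷ fwd xs gs
  bwd : ∀ xs → All (λ x → F x → G x) xs → All G (filter F? xs)
  bwd []       gs = []
  bwd (x ∷ xs) (g ∷ gs) with F? x
  ... | yes f = g f ∷ bwd xs gs
  ... | no _  = bwd xs gs

-- SE-models

SatReduct : Interp → Interp → Rule → Set
SatReduct X Y r = All (_∉ Y) (B⁻ r) → X ⊨ mkRule (H r) (B⁺ r) []

⊨P-reduct⇔ : ∀ P → (X ⊨P reduct P Y) ⇔ All (SatReduct X Y) P
⊨P-reduct⇔ {Y = Y} P = mk⇔ (to F ∘ map⁻) (map⁺ ∘ from F)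
  where F = All-filter⇔ (λ r → all? (λ a → ¬? (a ∈? Y)) (B⁻ r)) P

-- For `lpmln`, the guard `Y ⊨ r` stands for restricting the program to the rules that `Y`
-- satisfies. It mentions `Y` alone, so it is the same for every candidate `X` below `Y`.
SatSE : Semantics → Interp → Interp → Rule → Set
SatSE asp   X Y r = SatReduct X Y r
SatSE lpmln X Y r = Y ⊨ r → SatReduct X Y r

SatSE? : ∀ s X Y → Decidable (SatSE s X Y)
SatSE? asp   X Y r = all? (λ a → ¬? (a ∈? Y)) (B⁻ r) →-dec (X ⊨? mkRule (H r) (B⁺ r) [])
SatSE? lpmln X Y r = (Y ⊨? r) →-dec SatSE? asp X Y r

SatReduct⇒SatSE : ∀ s → SatReduct X Y r → SatSE s X Y r
SatReduct⇒SatSE asp   p = p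
SatReduct⇒SatSE lpmln p = λ _ → p

SatSE⇒SatReduct : ∀ s → Y ⊨ r → SatSE s X Y r → SatReduct X Y r
SatSE⇒SatReduct asp   _ p = p
SatSE⇒SatReduct lpmln m p = p m

SE : Semantics → Interp → Interp → Program → Set
SE s X Y P = All (SatSE s Y Y) P × All (SatSE s X Y) P

Minimal : Semantics → Program → Interp → Set
Minimal s P Y = ∀ X → X ⊆ Y → ¬ (Y ⊆ X) → ¬ All (SatSE s X Y) P

-- With all filters gone, both semantics have one shape: a conjunction over rules, which splits
-- along `P ++ R`.
Stable⇔ : ∀ s P Y → Stable s P Y ⇔ (All (SatSE s Y Y) P × Minimal s P Y)
Stable⇔ asp P Y = mk⇔
  (λ (m , ¬z) → to (⊨P-reduct⇔ P) m , λ X X⊆ ⊈X z → ¬z (X , X⊆ , ⊈X , from (⊨P-reduct⇔ P) z))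
  (λ (m , ¬z) → from (⊨P-reduct⇔ P) m , λ (X , X⊆ , ⊈X , z) → ¬z X X⊆ ⊈X (to (⊨P-reduct⇔ P) z))
Stable⇔ lpmln P Y = mk⇔
  (λ (m , ¬z) → to sat m , λ X X⊆ ⊈X z → ¬z (X , X⊆ , ⊈X , from sat z))
  (λ (m , ¬z) → from sat m , λ (X , X⊆ , ⊈X , z) → ¬z X X⊆ ⊈X (to sat z))
  where
  sat : ∀ {X} → (X ⊨P reduct (satRules P Y) Y) ⇔ All (SatSE lpmln X Y) P
  sat = mk⇔ (to F ∘ to G) (from G ∘ from F)
    where
    F = All-filter⇔ (Y ⊨?_) P
    G = ⊨P-reduct⇔ (satRules P Y)

-- Satisfaction of a rule depends only on these three truth values, so matching them allows both the
-- interpretation and the rule to change at once.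
record Agree (X : Interp) (r : Rule) (X' : Interp) (r' : Rule) : Set where
  field
    onH  : Any (_∈ X) (H r) ⇔ Any (_∈ X') (H r')
    onB⁺ : All (_∈ X) (B⁺ r) ⇔ All (_∈ X') (B⁺ r')
    onB⁻ : Any (_∈ X) (B⁻ r) ⇔ Any (_∈ X') (B⁻ r')
open Agree

Agree-sym : Agree X r X' r' → Agree X' r' X r
Agree-sym g = record { onH = ⇔-sym (onH g) ; onB⁺ = ⇔-sym (onB⁺ g) ; onB⁻ = ⇔-sym (onB⁻ g) }

Agree-⊨ : Agree X r X' r' → X ⊨ r → X' ⊨ r'
Agree-⊨ g = Sum.map (to (onH g)) (Sum.map (_∘ from (onB⁺ g)) (to (onB⁻ g)))

Agree-SatReduct : Agree X r X' r' → Agree Y r Y' r' → SatReduct X Y r → SatReduct X' Y' r'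
Agree-SatReduct g k p n =
  Sum.map (to (onH g)) (Sum.map (_∘ from (onB⁺ g)) λ ())
    -- Reducts test negative bodies at `Y` and everything else at `X`, so `k` enters only through
    -- `onB⁻`, contrapositively.
    (p (¬Any⇒All¬ _ (All¬⇒¬Any n ∘ to (onB⁻ k))))

Agree-SatSE : ∀ s → Agree X r X' r' → Agree Y r Y' r' → SatSE s X Y r → SatSE s X' Y' r'
Agree-SatSE asp   g k p   = Agree-SatReduct g k p
Agree-SatSE lpmln g k p m = Agree-SatReduct g k (p (Agree-⊨ (Agree-sym k) m))

Any-cong : (∀ {b} → b ∈ A → b ∈ X ⇔ b ∈ X') → Any (_∈ X) A ⇔ Any (_∈ X') A
Any-cong e = mk⇔ (go (to ∘ e)) (go (from ∘ e))
  where
  go : ∀ {A X X'} → (∀ {b} → b ∈ A → b ∈ X → b ∈ X') → Any (_∈ X) A → Any (_∈ X') A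
  go f (here p)  = here (f (here refl) p)
  go f (there p) = there (go (f ∘ there) p)

All-cong : (∀ {b} → b ∈ A → b ∈ X ⇔ b ∈ X') → All (_∈ X) A ⇔ All (_∈ X') A
All-cong e = mk⇔
  (λ p → All.tabulate (λ b∈ → to (e b∈) (All.lookup p b∈)))
  (λ p → All.tabulate (λ b∈ → from (e b∈) (All.lookup p b∈)))

Agree-refl : X ⊆ X' → X' ⊆ X → Agree X r X' r
Agree-refl i j = record { onH = Any-cong (λ _ → e) ; onB⁺ = All-cong (λ _ → e) ; onB⁻ = Any-cong (λ _ → e) }
  where
  e : ∀ {b} → b ∈ _ ⇔ b ∈ _
  e = mk⇔ i j

SatSE-cong : ∀ s → X ⊆ X' → X' ⊆ X → SatSE s X Y r → SatSE s X' Y r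
SatSE-cong s i j = Agree-SatSE s (Agree-refl i j) (Agree-refl id id)

-- Strong equivalence as equality of SE-models

fact : Atom → Rule
fact x = mkRule (x ∷ []) [] []

implication : Atom → Atom → Rule
implication x y = mkRule (y ∷ []) (x ∷ []) []

-- For X ⊆ Y, its models among the subsets of Y are exactly X and Y.
context : Interp → Interp → Program
context X Y = map fact X ++ cartesianProductWith implication (filter (λ y → ¬? (y ∈? X)) Y) Y

-- The facts hold by `X ⊆ Z`. An implication from outside `X` into `Y` has a false premise when
-- `Z ⊆ X` and a true conclusion when `Y ⊆ Z`.
context-sat : ∀ s → X ⊆ Z → Z ⊆ X ⊎ Y ⊆ Z → All (SatSE s Z Y) (context X Y)
context-sat {X} {Z} {Y} s X⊆Z c = ++⁺
  (map⁺ (All.tabulate (λ x∈X → SatReduct⇒SatSE s (λ _ → inj₁ (here (X⊆Z x∈X))))))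
  (All.tabulate go)
  where
  outside = filter (λ y → ¬? (y ∈? X)) Y
  sat : ∀ {x y} → x ∉ X → y ∈ Y → Z ⊆ X ⊎ Y ⊆ Z → Z ⊨ implication x y
  sat x∉X y∈Y (inj₁ Z⊆X) = inj₂ (inj₁ (λ { (x∈Z ∷ []) → x∉X (Z⊆X x∈Z) }))
  sat x∉X y∈Y (inj₂ Y⊆Z) = inj₁ (here (Y⊆Z y∈Y))
  go : ∀ {r} → r ∈ cartesianProductWith implication outside Y → SatSE s Z Y r
  go r∈ with ∈-cartesianProductWith⁻ implication outside Y r∈
  ... | x , y , x∈ , y∈ , refl =
    SatReduct⇒SatSE s (λ _ → sat (proj₂ (∈-filter⁻ (λ y → ¬? (y ∈? X)) {xs = Y} x∈)) y∈ c)

-- The facts force `X` into `Z`, and a single atom of `Z` outside `X` fires implications to all of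
-- `Y`. The `lpmln` guard is met because every head in the context lies in `Y`.
context-models : ∀ s → X ⊆ Y → Z ⊆ Y → All (SatSE s Z Y) (context X Y) → X ⊆ Z × (Z ⊆ X ⊎ Y ⊆ Z)
context-models {X} {Y} {Z} s X⊆Y Z⊆Y p = X⊆Z , dichotomy
  where
  facts = map⁻ (proj₁ (++⁻ (map fact X) p))
  implications = proj₂ (++⁻ (map fact X) p)
  X⊆Z : X ⊆ Z
  X⊆Z x∈X with SatSE⇒SatReduct s (inj₁ (here (X⊆Y x∈X))) (All.lookup facts x∈X) []
  ... | inj₁ (here x∈Z)  = x∈Z
  ... | inj₂ (inj₁ ¬[])  = ⊥-elim (¬[] [])
  Y⊆ : ∀ {x} → x ∈ Z → x ∉ X → Y ⊆ Z
  Y⊆ x∈Z x∉X y∈Y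
    with SatSE⇒SatReduct s (inj₁ (here y∈Y))
           (All.lookup implications (∈-cartesianProductWith⁺ implication
             (∈-filter⁺ (λ y → ¬? (y ∈? X)) (Z⊆Y x∈Z) x∉X) y∈Y)) []
  ... | inj₁ (here y∈Z) = y∈Z
  ... | inj₂ (inj₁ ¬x)  = ⊥-elim (¬x (x∈Z ∷ []))
  dichotomy : Z ⊆ X ⊎ Y ⊆ Z
  dichotomy with all? (_∈? X) Z
  ... | yes q = inj₁ (All.lookup q)
  ... | no ¬q with find (¬All⇒Any¬ (_∈? X) Z ¬q)
  ...   | x , x∈Z , x∉X = inj₂ (Y⊆ x∈Z x∉X)

StrongEq-sym : ∀ s → StrongEq s P Q → StrongEq s Q P
StrongEq-sym s e R X = ⇔-sym (e R X)

-- The facts of `context Y Y` exclude every proper subset of `Y`, so in this context stability of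
-- `Y` reduces to its being a model.
StrongEq⇒total : ∀ s → StrongEq s P Q → All (SatSE s Y Y) P → All (SatSE s Y Y) Q
StrongEq⇒total {P} {Q} {Y} s e p =
  proj₁ (++⁻ Q (proj₁ (to (Stable⇔ s _ Y) (to (e (context Y Y) Y) stable))))
  where
  stable : Stable s (P ++ context Y Y) Y
  stable = from (Stable⇔ s _ Y)
    ( ++⁺ p (context-sat s id (inj₁ id))
    , λ Z Z⊆Y Y⊈Z z → Y⊈Z (proj₁ (context-models s id Z⊆Y (proj₂ (++⁻ P z)))) )

-- `SatSE` is decidable, so suppose that `X` fails for `Q`. Then no proper subset of `Y` satisfies
-- `Q` together with `context X Y`, and `Y` is stable there. Strong equivalence makes `Y` stable for
-- `P` in the same context, although `X` is a smaller model.
StrongEq⇒SE : ∀ s → StrongEq s P Q → X ⊆ Y → SE s X Y P → SE s X Y Q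
StrongEq⇒SE {P} {Q} {X} {Y} s e X⊆Y (total , p) = totalQ , q
  where
  totalQ : All (SatSE s Y Y) Q
  totalQ = StrongEq⇒total s e total
  q : All (SatSE s X Y) Q
  q with all? (SatSE? s X Y) Q
  ... | yes q = q
  ... | no ¬q = ⊥-elim
    (proj₂ (to (Stable⇔ s _ Y) (from (e (context X Y) Y) stable)) X X⊆Y Y⊈X
      (++⁺ p (context-sat s id (inj₁ id))))
    where
    Y⊈X : ¬ (Y ⊆ X)
    -- Otherwise `X` and `Y` would have the same elements, and `totalQ` would contradict the failure
    -- of `X`.
    Y⊈X Y⊆X = ¬q (All.map (SatSE-cong s Y⊆X X⊆Y) totalQ)
    minimal : Minimal s (Q ++ context X Y) Y
    minimal Z Z⊆Y Y⊈Z z with context-models s X⊆Y Z⊆Y (proj₂ (++⁻ Q z))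
    ... | X⊆Z , inj₁ Z⊆X = ¬q (All.map (SatSE-cong s Z⊆X X⊆Z) (proj₁ (++⁻ Q z)))
    ... | X⊆Z , inj₂ Y⊆Z = Y⊈Z Y⊆Z
    stable : Stable s (Q ++ context X Y) Y
    stable = from (Stable⇔ s _ Y) (++⁺ totalQ (context-sat s X⊆Y (inj₂ id)) , minimal)

-- Stability of `Y` depends only on the SE-models with second member `Y`, and the part of `R` is
-- carried along unchanged. Modelhood passes forward from `P` to `Q`; a smaller model of `Q` passes
-- back to `P`.
SE⇒StrongEq : ∀ s → (∀ {X Y} → X ⊆ Y → SE s X Y P ⇔ SE s X Y Q) → StrongEq s P Q
SE⇒StrongEq s e R Y = mk⇔ (go (to ∘ e) (from ∘ e)) (go (from ∘ e) (to ∘ e))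
  where
  go : ∀ {P Q} → (∀ {X} → X ⊆ Y → SE s X Y P → SE s X Y Q) →
    (∀ {X} → X ⊆ Y → SE s X Y Q → SE s X Y P) →
    Stable s (P ++ R) Y → Stable s (Q ++ R) Y
  go {P} {Q} f g st with to (Stable⇔ s _ Y) st
  ... | t , minimal with ++⁻ P t
  ... | tP , tR = from (Stable⇔ s _ Y) (++⁺ tQ tR , minimal')
    where
    tQ : All (SatSE s Y Y) Q
    tQ = proj₁ (f id (tP , tP))
    minimal' : Minimal s (Q ++ R) Y
    minimal' X X⊆Y Y⊈X m with ++⁻ Q m
    ... | mQ , mR = minimal X X⊆Y Y⊈X (++⁺ (proj₂ (g X⊆Y (tQ , mQ))) mR)

-- Adding a fresh atom

Fresh : Atom → Rule → Set
Fresh a r = ∀ c → a ∉ comp c r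

-- The addition of an atom seen at one rule, with the disjointness demanded by `NSV` expressed on
-- the flags.
record Extends (a : Atom) (r r' : Rule) : Set where
  constructor extends
  field
    N        : Comp → Bool
    fresh    : Fresh a r
    pos∩head : N pos ≡ true → N head ≡ false
    pos∩neg  : N pos ≡ true → N neg ≡ false
    added    : r' ≡ addRule N a r

infixl 6 _∖_
_∖_ : Interp → Atom → Interp
X ∖ a = filter (λ b → ¬? (b ≟ a)) X

∉-∖ : ∀ X → a ∉ X ∖ a
∉-∖ {a} X a∈ = proj₂ (∈-filter⁻ (λ b → ¬? (b ≟ a)) {xs = X} a∈) refl

∖-mono : X ⊆ Y → X ∖ a ⊆ Y ∖ a
∖-mono {X} {Y} {a} X⊆Y b∈ with ∈-filter⁻ (λ b → ¬? (b ≟ a)) {xs = X} b∈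
... | b∈X , b≢a = ∈-filter⁺ (λ b → ¬? (b ≟ a)) (X⊆Y b∈X) b≢a

∷-mono : X ⊆ Y → a ∷ X ⊆ a ∷ Y
∷-mono X⊆Y (here e)  = here e
∷-mono X⊆Y (there i) = there (X⊆Y i)

∈-∖⇔ : a ∉ A → b ∈ A → b ∈ X ⇔ b ∈ X ∖ a
∈-∖⇔ {a} {X = X} a∉A b∈A = mk⇔
  (λ b∈X → ∈-filter⁺ (λ b → ¬? (b ≟ a)) b∈X (λ { refl → a∉A b∈A }))
  (λ b∈ → proj₁ (∈-filter⁻ (λ b → ¬? (b ≟ a)) {xs = X} b∈))

∈-∷⇔ : a ∉ A → b ∈ A → b ∈ X ⇔ b ∈ a ∷ X
∈-∷⇔ a∉A b∈A = mk⇔ there λ { (here refl) → ⊥-elim (a∉A b∈A) ; (there b∈X) → b∈X }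

Any-∖⇔ : ∀ h → a ∉ A → Any (_∈ X) A ⇔ Any (_∈ X ∖ a) (addIf h a A)
Any-∖⇔ false a∉A = Any-cong (∈-∖⇔ a∉A)
Any-∖⇔ {X = X} true a∉A = mk⇔ (there ∘ to (Any-cong (∈-∖⇔ a∉A)))
  λ { (here a∈) → ⊥-elim (∉-∖ X a∈) ; (there p) → from (Any-cong (∈-∖⇔ a∉A)) p }

All-∷⇔ : ∀ p → a ∉ A → All (_∈ X) A ⇔ All (_∈ a ∷ X) (addIf p a A)
All-∷⇔ false a∉A = All-cong (∈-∷⇔ a∉A)
All-∷⇔ true  a∉A = mk⇔ ((here refl ∷_) ∘ to (All-cong (∈-∷⇔ a∉A)))
  λ { (_ ∷ q) → from (All-cong (∈-∷⇔ a∉A)) q }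

module _ (N : Comp → Bool) (fresh : Fresh a r) where

  -- A false atom added to a disjunction changes nothing, but it would falsify the conjunction `B⁺`;
  -- hence the condition on `pos`. Since `r` does not mention `a`, it is irrelevant whether `X`
  -- contains `a`.
  Agree-∖ : ∀ X → N pos ≡ false → Agree X r (X ∖ a) (addRule N a r)
  Agree-∖ X p rewrite p = record
    { onH  = Any-∖⇔ (N head) (fresh head)
    ; onB⁺ = All-cong (∈-∖⇔ (fresh pos))
    ; onB⁻ = Any-∖⇔ (N neg) (fresh neg)
    }

  -- Dually, a true atom is harmless in the conjunction `B⁺` but would make `H` or `B⁻` hold.
  Agree-∷ : ∀ X → N head ≡ false → N neg ≡ false → Agree X r (a ∷ X) (addRule N a r)
  Agree-∷ X h n rewrite h | n = record
    { onH  = Any-cong (∈-∷⇔ (fresh head))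
    ; onB⁺ = All-∷⇔ (N pos) (fresh pos)
    ; onB⁻ = Any-cong (∈-∷⇔ (fresh neg))
    }

module _ (N : Comp → Bool) where

  SatSE-∖-pos : ∀ s X Y → N pos ≡ true → SatSE s (X ∖ a) Y (addRule N a r)
  SatSE-∖-pos s X Y p rewrite p =
    SatReduct⇒SatSE s (λ _ → inj₂ (inj₁ λ { (a∈ ∷ _) → ∉-∖ X a∈ }))

  SatSE-∷-head : ∀ s X Y → N head ≡ true → SatSE s (a ∷ X) Y (addRule N a r)
  SatSE-∷-head s X Y h rewrite h = SatReduct⇒SatSE s (λ _ → inj₁ (here (here refl)))

  SatSE-∷-neg : ∀ s X Y → N neg ≡ true → SatSE s X (a ∷ Y) (addRule N a r)
  SatSE-∷-neg s X Y n rewrite n =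
    SatReduct⇒SatSE s λ { (a∉ ∷ _) → ⊥-elim (a∉ (here refl)) }

true-or-false : ∀ x → x ≡ true ⊎ x ≡ false
true-or-false true  = inj₁ refl
true-or-false false = inj₂ refl

SatSE-extends : ∀ s X Y → Extends a r r' →
  SatSE s X Y r ⇔ (SatSE s (X ∖ a) (Y ∖ a) r' × SatSE s (a ∷ X) (a ∷ Y) r')
SatSE-extends {a} {r} s X Y (extends N fresh ph pn refl) = mk⇔ (λ q → without q , with-a q) back
  where
  r⊕ = addRule N a r
  without : SatSE s X Y r → SatSE s (X ∖ a) (Y ∖ a) r⊕
  without q with true-or-false (N pos)
  ... | inj₁ p = SatSE-∖-pos N s X (Y ∖ a) p
  ... | inj₂ p = Agree-SatSE s (Agree-∖ N fresh X p) (Agree-∖ N fresh Y p) q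
  with-a : SatSE s X Y r → SatSE s (a ∷ X) (a ∷ Y) r⊕
  with-a q with true-or-false (N head) | true-or-false (N neg)
  ... | inj₁ h | _      = SatSE-∷-head N s X (a ∷ Y) h
  ... | inj₂ _ | inj₁ n = SatSE-∷-neg N s (a ∷ X) Y n
  ... | inj₂ h | inj₂ n = Agree-SatSE s (Agree-∷ N fresh X h n) (Agree-∷ N fresh Y h n) q
  back : SatSE s (X ∖ a) (Y ∖ a) r⊕ × SatSE s (a ∷ X) (a ∷ Y) r⊕ → SatSE s X Y r
  -- One of the two pairs always determines `r`: the pair with `a` if `a` was added to the positive
  -- body, where the flags exclude the head and the negative body, and otherwise the pair without
  -- `a`.
  back (q₀ , q₁) with true-or-false (N pos)
  ... | inj₁ p = Agree-SatSE s (Agree-sym (Agree-∷ N fresh X (ph p) (pn p)))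
                             (Agree-sym (Agree-∷ N fresh Y (ph p) (pn p))) q₁
  ... | inj₂ p = Agree-SatSE s (Agree-sym (Agree-∖ N fresh X p)) (Agree-sym (Agree-∖ N fresh Y p)) q₀

All-SatSE-extends : ∀ s X Y → Pointwise (Extends a) P P' →
  All (SatSE s X Y) P ⇔ (All (SatSE s (X ∖ a) (Y ∖ a)) P' × All (SatSE s (a ∷ X) (a ∷ Y)) P')
All-SatSE-extends s X Y []       = mk⇔ (λ _ → [] , []) (λ _ → [])
All-SatSE-extends s X Y (e ∷ es) = mk⇔
  (λ { (q ∷ qs) → let q₀ , q₁ = to (SatSE-extends s X Y e) q
                      qs₀ , qs₁ = to (All-SatSE-extends s X Y es) qs
                  in q₀ ∷ qs₀ , q₁ ∷ qs₁ })
  (λ { (q₀ ∷ qs₀ , q₁ ∷ qs₁) → from (SatSE-extends s X Y e) (q₀ , q₁)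
                             ∷ from (All-SatSE-extends s X Y es) (qs₀ , qs₁) })

SE-extends : ∀ s X Y → Pointwise (Extends a) P P' →
  SE s X Y P ⇔ (SE s (X ∖ a) (Y ∖ a) P' × SE s (a ∷ X) (a ∷ Y) P')
SE-extends s X Y es = mk⇔
  (λ (t , q) → let t₀ , t₁ = to (All-SatSE-extends s Y Y es) t
                   q₀ , q₁ = to (All-SatSE-extends s X Y es) q
               in (t₀ , q₀) , (t₁ , q₁))
  (λ ((t₀ , q₀) , (t₁ , q₁)) →
    from (All-SatSE-extends s Y Y es) (t₀ , t₁) , from (All-SatSE-extends s X Y es) (q₀ , q₁))

-- Removing or adding `a` in both members preserves `X ⊆ Y`, so `StrongEq⇒SE` applies to each of the
-- two pairs.
StrongEq-extends : ∀ s → Pointwise (Extends a) P P' → Pointwise (Extends a) Q Q' →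
  StrongEq s P' Q' → StrongEq s P Q
StrongEq-extends {a} s ps qs e = SE⇒StrongEq s λ X⊆Y →
  mk⇔ (go ps qs e X⊆Y) (go qs ps (StrongEq-sym s e) X⊆Y)
  where
  go : ∀ {P P' Q Q' X Y} → Pointwise (Extends a) P P' → Pointwise (Extends a) Q Q' →
    StrongEq s P' Q' → X ⊆ Y → SE s X Y P → SE s X Y Q
  go {X = X} {Y} ps qs e X⊆Y m =
    let m₀ , m₁ = to (SE-extends s X Y ps) m
    in from (SE-extends s X Y qs)
         (StrongEq⇒SE s e (∖-mono X⊆Y) m₀ , StrongEq⇒SE s e (∷-mono X⊆Y) m₁)

-- From the extended tuple to its single rules

∈-addIf : ∀ {h} → h ≡ true → a ∈ addIf h a A
∈-addIf refl = here refl

-- Were `a` flagged for the positive body and another component of one rule, it would lie in both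
-- after the addition, against the disjointness in the extended tuple.
addAtom-extends : ∀ T (N : Positions T) → ¬ InAt T a →
  All (λ r → Disjoint (B⁺ r) (H r) × Disjoint (B⁺ r) (B⁻ r)) (addAtom T N a) →
  Pointwise (Extends a) T (addAtom T N a)
addAtom-extends []      N fresh []               = []
addAtom-extends {a} (r ∷ T) N fresh ((ph , pn) ∷ ds) =
  extends (N zero) (λ c a∈ → fresh (zero , c , a∈)) (exclusive ph) (exclusive pn) refl
  ∷ addAtom-extends T (N ∘ suc) (λ (i , c , a∈) → fresh (suc i , c , a∈)) ds
  where
  exclusive : ∀ {h p A B} → Disjoint (addIf p a A) (addIf h a B) → p ≡ true → h ≡ false
  exclusive {false} d _ = refl
  exclusive {true}  d p = ⊥-elim (d a (∈-addIf p) (here refl))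

-- The right-hand list is not given as a concatenation, so its halves are cut out by the length of
-- `xs`, as in the theorem.
Pointwise-++⁻ : ∀ {E F : Set} {_∼_ : E → F → Set} xs {ys zs} → Pointwise _∼_ (xs ++ ys) zs →
  Pointwise _∼_ xs (take (length xs) zs) × Pointwise _∼_ ys (drop (length xs) zs)
Pointwise-++⁻ []       ps       = [] , ps
Pointwise-++⁻ (x ∷ xs) (p ∷ ps) = let qs , rs = Pointwise-++⁻ xs ps in p ∷ qs , rs

theorem9 : (sem : Semantics) (P Q : Program) →
    NSV (P ++ Q) →
    (N : Positions (P ++ Q)) → NonEmpty {P ++ Q} N →
    (a' : Atom) → ¬ InAt (P ++ Q) a' →
    NSV (addAtom (P ++ Q) N a') →
    (¬ StrongEq sem P Q →
       ¬ StrongEq sem (take (length P) (addAtom (P ++ Q) N a'))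
                      (drop (length P) (addAtom (P ++ Q) N a')))
    ×
    (StrongEq sem (take (length P) (addAtom (P ++ Q) N a'))
                  (drop (length P) (addAtom (P ++ Q) N a')) →
       StrongEq sem P Q)
theorem9 sem P Q _ N _ a' fresh (_ , disjoint) = (_∘ reflects) , reflects
  where
  split = Pointwise-++⁻ P (addAtom-extends (P ++ Q) N fresh disjoint)
  -- This is the second implication; the first is its contrapositive.
  reflects = StrongEq-extends sem (proj₁ split) (proj₂ split)
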